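{- Let $G$, $H$, $K$ be impartial games. Then $(G\circ H)\circ K = G\circ (H+K)$, where $=$ denotes equality of games (equivalently, $(G\circ H)\circ K + G\circ(H+K)$ is a $\mathcal{P}$-position).
   Context: All games are finite (short) impartial games under normal play. A game is identified with its set of options; $\mathbf{E}$ denotes the game with no options, and $\equiv$ denotes identity of games (same set of options, recursively). The disjunctive sum is the game $G+H \equiv \{g+H,\ G+h\}$ ($g$ ranging over options of $G$, $h$ over options of $H$), so $\mathbf{E}+\mathbf{E}\equiv\mathbf{E}$. A $\mathcal{P}$-position is a game all of whose options are $\mathcal{N}$-positions; an $\mathcal{N}$-position has some option that is a $\mathcal{P}$-position. Two games are equal, $G=H$, if $G+X$ and $H+X$ have the same outcome ($\mathcal{P}$ or $\mathcal{N}$) for every game $X$; for impartial games this holds iff $G+H$ is a $\mathcal{P}$-position. The split sum is defined recursively by: $G\circ H \equiv \mathbf{E}$ if $G\equiv \mathbf{E}$; $G\circ H\equiv G$ if $H\equiv\mathbf{E}$ (and $G\not\equiv\mathbf{E}$); otherwise $G\circ H \equiv \{G\circ h,\ g\circ H\}$. -}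

module Defs where

open import Data.List using (List; []; _∷_; _++_)
open import Data.List.Relation.Unary.All using (All)
open import Data.List.Relation.Unary.Any using (Any)
open import Data.Product using (_×_)
open import Function.Bundles using (_⇔_)

infixl 6 _+_
infixl 7 _∘_
infix  4 _≈_

-- A finite set of options is presented by a list; order and repetitions are
-- immaterial. Identity of games (recursively, the same set of options) is thus
-- coarser than propositional equality of lists, but the only game identical to
-- E is node [] itself, so the tests "G ≡ E" below are pattern matches on [].
data Game : Set where
  node : List Game → Game

E : Game
E = node []

-- The auxiliary functions gs +ˡ H and G +ʳ hs are the lists of all g + H and
-- of all G + h; they are map unfolded for the termination checker.
mutual
  _+_ : Game → Game → Game
  G@(node gs) + H@(node hs) = node (gs +ˡ H ++ G +ʳ hs)

  infixl 6 _+ˡ_ _+ʳ_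

  _+ˡ_ : List Game → Game → List Game
  []       +ˡ H = []
  (g ∷ gs) +ˡ H = (g + H) ∷ (gs +ˡ H)

  _+ʳ_ : Game → List Game → List Game
  G +ʳ []       = []
  G +ʳ (h ∷ hs) = (G + h) ∷ (G +ʳ hs)

-- Split sum, with gs ∘ˡ H and G ∘ʳ hs the lists of all g ∘ H and of all G ∘ h.
mutual
  _∘_ : Game → Game → Game
  node []            ∘ H                  = E
  G@(node (_ ∷ _))   ∘ node []            = G
  G@(node gs@(_ ∷ _)) ∘ H@(node hs@(_ ∷ _)) = node (G ∘ʳ hs ++ gs ∘ˡ H)

  infixl 7 _∘ˡ_ _∘ʳ_

  _∘ˡ_ : List Game → Game → List Game
  []       ∘ˡ H = []
  (g ∷ gs) ∘ˡ H = (g ∘ H) ∷ (gs ∘ˡ H)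

  _∘ʳ_ : Game → List Game → List Game
  G ∘ʳ []       = []
  G ∘ʳ (h ∷ hs) = (G ∘ h) ∷ (G ∘ʳ hs)

mutual
  data IsP : Game → Set where
    isP : ∀ {gs} → All IsN gs → IsP (node gs)

  data IsN : Game → Set where
    isN : ∀ {gs} → Any IsP gs → IsN (node gs)

SameOutcome : Game → Game → Set
SameOutcome G H = (IsP G ⇔ IsP H) × (IsN G ⇔ IsN H)

-- Equality of games, as opposed to identity.
_≈_ : Game → Game → Set
G ≈ H = (X : Game) → SameOutcome (G + X) (H + X)

{-# OPTIONS --safe #-}

-- The two sides are even identical as games. If G, H and K all have options,
-- those of (G ∘ H) ∘ K are (G ∘ H) ∘ k, (G ∘ h) ∘ K and (g ∘ H) ∘ K, and those of
-- G ∘ (H + K) are G ∘ (H + k), G ∘ (h + K) and g ∘ (H + K), which agree by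
-- induction. If one of the three is E, both sides collapse to the same game.

module Submission where

open import Data.List using (List; []; _∷_; _++_; map)
open import Data.List.Properties using (++-identityʳ; ++-assoc)
open import Data.List.Relation.Binary.Permutation.Propositional using (_↭_; ↭-refl; ↭-sym; ↭-trans; ↭-reflexive)
open import Data.List.Relation.Binary.Permutation.Propositional.Properties using (All-resp-↭; Any-resp-↭; map⁺; ++⁺ʳ; ++-comm)
open import Data.List.Relation.Binary.Pointwise using (Pointwise; []; _∷_; ++⁺)
open import Data.List.Relation.Unary.All using (All; []; _∷_)
open import Data.List.Relation.Unary.Any using (Any; here; there)
open import Data.Product using (_,_; proj₁; proj₂)
open import Function.Bundles using (_⇔_; mk⇔; Equivalence)
open import Relation.Binary.PropositionalEquality using (_≡_; refl; sym; trans; cong; cong₂; subst₂)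
open import Defs

open Equivalence using (to; from)

-- Finer than identity of games, since repeated options are counted.
infix 4 _≅_
data _≅_ : Game → Game → Set where
  node : ∀ {gs hs ks} → Pointwise _≅_ gs hs → hs ↭ ks → node gs ≅ node ks

mutual
  ≅-refl : ∀ G → G ≅ G
  ≅-refl (node gs) = node (≅-refls gs) ↭-refl

  ≅-refls : ∀ gs → Pointwise _≅_ gs gs
  ≅-refls []       = []
  ≅-refls (g ∷ gs) = ≅-refl g ∷ ≅-refls gs

≅-reflexive : ∀ {G H} → G ≡ H → G ≅ H
≅-reflexive {G} refl = ≅-refl G

mutual
  -- Whether all options are `IsN`, or some option is `IsP`, does not depend on the order of the
  -- options. The `IsP` half for a game calls the `IsN` half for its options and vice versa, so both
  -- are proved together.
  ≅⇒SameOutcome : ∀ {G H} → G ≅ H → SameOutcome G H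
  ≅⇒SameOutcome (node gs≅hs hs↭ks) =
    mk⇔ (λ { (isP ns) → isP (All-resp-↭ hs↭ks (to (allN gs≅hs) ns)) })
        (λ { (isP ns) → isP (from (allN gs≅hs) (All-resp-↭ (↭-sym hs↭ks) ns)) }) ,
    mk⇔ (λ { (isN p) → isN (Any-resp-↭ hs↭ks (to (anyP gs≅hs) p)) })
        (λ { (isN p) → isN (from (anyP gs≅hs) (Any-resp-↭ (↭-sym hs↭ks) p)) })

  allN : ∀ {gs hs} → Pointwise _≅_ gs hs → All IsN gs ⇔ All IsN hs
  allN []             = mk⇔ (λ _ → []) (λ _ → [])
  allN (g≅h ∷ gs≅hs) =
    mk⇔ (λ { (n ∷ ns) → to (proj₂ (≅⇒SameOutcome g≅h)) n ∷ to (allN gs≅hs) ns })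
        (λ { (n ∷ ns) → from (proj₂ (≅⇒SameOutcome g≅h)) n ∷ from (allN gs≅hs) ns })

  anyP : ∀ {gs hs} → Pointwise _≅_ gs hs → Any IsP gs ⇔ Any IsP hs
  anyP []             = mk⇔ (λ ()) (λ ())
  anyP (g≅h ∷ gs≅hs) =
    mk⇔ (λ { (here p)  → here (to (proj₁ (≅⇒SameOutcome g≅h)) p)
           ; (there p) → there (to (anyP gs≅hs) p) })
        (λ { (here p)  → here (from (proj₁ (≅⇒SameOutcome g≅h)) p)
           ; (there p) → there (from (anyP gs≅hs) p) })

-- Brings `_+ˡ_` into the form to which `map⁺` applies, so that permutations of options pass through
-- it.
+ˡ≡map : ∀ gs X → gs +ˡ X ≡ map (_+ X) gs
+ˡ≡map []       X = refl
+ˡ≡map (g ∷ gs) X = cong (g + X ∷_) (+ˡ≡map gs X)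

+ˡ-resp-↭ : ∀ {gs hs} X → gs ↭ hs → gs +ˡ X ↭ hs +ˡ X
+ˡ-resp-↭ {gs} {hs} X gs↭hs =
  subst₂ _↭_ (sym (+ˡ≡map gs X)) (sym (+ˡ≡map hs X)) (map⁺ (_+ X) gs↭hs)

mutual
  -- One-sided congruence is enough, since `_≈_` adds the test game on the right.
  +-congʳ : ∀ {G H} → G ≅ H → ∀ X → G + X ≅ H + X
  +-congʳ {H = H} G≅H@(node gs≅hs hs↭ks) X@(node xs) =
    -- In the block `G +ʳ xs` the pointwise part already reaches `H`, so only the first block is
    -- left to permute.
    node (++⁺ (+ˡ-cong gs≅hs X) (+ʳ-cong G≅H xs))
         (++⁺ʳ (H +ʳ xs) (+ˡ-resp-↭ X hs↭ks))

  +ˡ-cong : ∀ {gs hs} → Pointwise _≅_ gs hs → ∀ X → Pointwise _≅_ (gs +ˡ X) (hs +ˡ X)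
  +ˡ-cong []             X = []
  +ˡ-cong (g≅h ∷ gs≅hs) X = +-congʳ g≅h X ∷ +ˡ-cong gs≅hs X

  +ʳ-cong : ∀ {G H} → G ≅ H → ∀ xs → Pointwise _≅_ (G +ʳ xs) (H +ʳ xs)
  +ʳ-cong G≅H []       = []
  +ʳ-cong G≅H (x ∷ xs) = +-congʳ G≅H x ∷ +ʳ-cong G≅H xs

≅⇒≈ : ∀ {G H} → G ≅ H → G ≈ H
≅⇒≈ G≅H X = ≅⇒SameOutcome (+-congʳ G≅H X)

mutual
  +-identityˡ : ∀ G → E + G ≡ G
  +-identityˡ (node gs) = cong node (+ʳ-identityˡ gs)

  +ʳ-identityˡ : ∀ gs → E +ʳ gs ≡ gs
  +ʳ-identityˡ []       = refl
  +ʳ-identityˡ (g ∷ gs) = cong₂ _∷_ (+-identityˡ g) (+ʳ-identityˡ gs)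

mutual
  +-identityʳ : ∀ G → G + E ≡ G
  +-identityʳ (node gs) = cong node (trans (++-identityʳ (gs +ˡ E)) (+ˡ-identityʳ gs))

  +ˡ-identityʳ : ∀ gs → gs +ˡ E ≡ gs
  +ˡ-identityʳ []       = refl
  +ˡ-identityʳ (g ∷ gs) = cong₂ _∷_ (+-identityʳ g) (+ˡ-identityʳ gs)

∘ˡ-++ : ∀ gs hs K → (gs ++ hs) ∘ˡ K ≡ gs ∘ˡ K ++ hs ∘ˡ K
∘ˡ-++ []       hs K = refl
∘ˡ-++ (g ∷ gs) hs K = cong (g ∘ K ∷_) (∘ˡ-++ gs hs K)

∘ʳ-++ : ∀ G hs ks → G ∘ʳ (hs ++ ks) ≡ G ∘ʳ hs ++ G ∘ʳ ks
∘ʳ-++ G []       ks = refl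
∘ʳ-++ G (h ∷ hs) ks = cong (G ∘ h ∷_) (∘ʳ-++ G hs ks)

++-swap : ∀ (as bs cs : List Game) → as ++ (bs ++ cs) ↭ (bs ++ as) ++ cs
++-swap as bs cs =
  ↭-trans (↭-reflexive (sym (++-assoc as bs cs))) (++⁺ʳ cs (++-comm as bs))

mutual
  ∘-∘-assoc-+ : ∀ G H K → (G ∘ H) ∘ K ≅ G ∘ (H + K)
  ∘-∘-assoc-+ (node []) H K = ≅-refl E
  ∘-∘-assoc-+ G@(node (_ ∷ _)) (node []) K =
    ≅-reflexive (cong (G ∘_) (sym (+-identityˡ K)))
  -- As `G` and `H` have options, `G ∘ H` computes to a game with a first option, so `(G ∘ H) ∘ E`
  -- reduces to `G ∘ H`.
  ∘-∘-assoc-+ G@(node (_ ∷ _)) H@(node (_ ∷ _)) (node []) =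
    ≅-reflexive (cong (G ∘_) (sym (+-identityʳ H)))
  ∘-∘-assoc-+ G@(node gs@(_ ∷ _)) H@(node hs@(_ ∷ _)) K@(node ks@(_ ∷ _)) =
    -- Once the concatenations are distributed, the left side lists the moves in `K`, `H`, `G` and
    -- the right side those in `H`, `K`, `G`; `++-swap` exchanges the first two blocks.
    subst₂ _≅_
      (cong (λ os → node ((G ∘ H) ∘ʳ ks ++ os)) (sym (∘ˡ-++ (G ∘ʳ hs) (gs ∘ˡ H) K)))
      (cong (λ os → node (os ++ gs ∘ˡ (H + K))) (sym (∘ʳ-++ G (hs +ˡ K) (H +ʳ ks))))
      (node (++⁺ (assocᵏ G H ks) (++⁺ (assocʰ G hs K) (assocᵍ gs H K)))
            (++-swap (G ∘ʳ (H +ʳ ks)) (G ∘ʳ (hs +ˡ K)) (gs ∘ˡ (H + K))))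

  -- This and the next two lemmas each descend in one of the three games and keep the other two
  -- fixed, which makes the mutual recursion structural.
  assocᵏ : ∀ G H ks → Pointwise _≅_ ((G ∘ H) ∘ʳ ks) (G ∘ʳ (H +ʳ ks))
  assocᵏ G H []       = []
  assocᵏ G H (k ∷ ks) = ∘-∘-assoc-+ G H k ∷ assocᵏ G H ks

  assocʰ : ∀ G hs K → Pointwise _≅_ ((G ∘ʳ hs) ∘ˡ K) (G ∘ʳ (hs +ˡ K))
  assocʰ G []       K = []
  assocʰ G (h ∷ hs) K = ∘-∘-assoc-+ G h K ∷ assocʰ G hs K

  assocᵍ : ∀ gs H K → Pointwise _≅_ ((gs ∘ˡ H) ∘ˡ K) (gs ∘ˡ (H + K))
  assocᵍ []       H K = []
  assocᵍ (g ∷ gs) H K = ∘-∘-assoc-+ g H K ∷ assocᵍ gs H K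

theorem2p4 : (G H K : Game) → (G ∘ H) ∘ K ≈ G ∘ (H + K)
theorem2p4 G H K = ≅⇒≈ (∘-∘-assoc-+ G H K)
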